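{- For any finite connected graph $G$ on $n$ vertices with minimum degree $\delta \geq 23$, the burning number of $G$ is at most $\lceil \sqrt{n}\,\rceil$.
   Context: Graphs are finite, simple, undirected and unweighted; $d(u,v)$ denotes the shortest-path distance. Burning process: it takes place in synchronous rounds $1,2,\dots$. In each round $i$, every vertex having a neighbour that was burned in an earlier round becomes burned, and additionally one chosen vertex $a_i$ (the activator of round $i$) becomes burned; burned vertices stay burned. A burning sequence $\langle a_1,\dots,a_m\rangle$ burns $G$ in $m$ rounds if all vertices are burned by the end of round $m$, equivalently if every vertex $v$ satisfies $d(v,a_i)\le m-i$ for some $i\in\{1,\dots,m\}$. The burning number of $G$ is the minimum $m$ for which there is a burning sequence that burns $G$ in $m$ rounds. -}

module Defs where

open import Data.Fin using (Fin)
open import Data.Fin.Properties using (_≟_; any?; all?)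
open import Data.List using (allFin; filter; length)
open import Data.Nat using (ℕ; zero; suc; _*_; _≤_; _≤?_; z≤n; s≤s)
open import Data.Nat.Properties using (m≤m*n)
open import Data.Product using (Σ; ∃; ∃-syntax; _×_; _,_; proj₁)
open import Data.Sum using (_⊎_; inj₁; inj₂)
open import Data.Vec as Vec using (Vec; []; _∷_)
open import Data.Vec.Membership.Propositional using (_∈_)
open import Data.Vec.Membership.Propositional.Properties using (∈-allFin⁺)
open import Data.Vec.Relation.Unary.Any using (here; there)
open import Function using (_∘_)
open import Level using (Level; 0ℓ)
open import Relation.Binary using (Rel; Symmetric; Irreflexive) renaming (Decidable to Decidable₂)
open import Relation.Binary.Construct.Closure.ReflexiveTransitive using (Star)
open import Relation.Binary.PropositionalEquality using (_≡_; refl)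
open import Relation.Nullary using (Dec; yes; no; contradiction; map′; _×-dec_; _⊎-dec_)
open import Relation.Unary using (Pred; Decidable; ∅)
open import Relation.Unary.Properties using (∅?)

private variable
  p : Level
  n m : ℕ

IsMinimum : Pred ℕ p → Pred ℕ p
IsMinimum P k = P k × (∀ j → P j → k ≤ j)

least : {P : Pred ℕ p} → Decidable P → ∃ P → ∃ (IsMinimum P)
least P? (N , pN) = search P? N pN
  where
  search : {P : Pred ℕ p} → Decidable P → ∀ N → P N → ∃ (IsMinimum P)
  search P? N pN with P? 0
  ... | yes p0 = 0 , p0 , λ _ _ → z≤n
  search P? zero    pN | no ¬p0 = contradiction pN ¬p0
  search P? (suc N) pN | no ¬p0 with search (P? ∘ suc) N pN
  ... | k , pk , min = suc k , pk , λ where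
    zero    p0 → contradiction p0 ¬p0
    (suc j) pj → s≤s (min j pj)

leastSquareRoot : ∀ n → ∃ (IsMinimum (λ k → n ≤ k * k))
leastSquareRoot n = least (λ k → n ≤? k * k) (n , bound n)
  where
  bound : ∀ n → n ≤ n * n
  bound zero      = z≤n
  bound n@(suc _) = m≤m*n n n

-- ⌈√ n ⌉ is the least integer k ≥ √n, i.e. the least k with n ≤ k².
⌈√_⌉ : ℕ → ℕ
⌈√ n ⌉ = proj₁ (leastSquareRoot n)

record Graph (n : ℕ) : Set₁ where
  field
    Adj    : Rel (Fin n) 0ℓ
    adj?   : Decidable₂ Adj
    sym    : Symmetric Adj
    irrefl : Irreflexive _≡_ Adj

module _ (G : Graph n) where
  open Graph G

  Connected : Set
  Connected = ∀ u v → Star Adj u v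

  degree : Fin n → ℕ
  degree v = length (filter (adj? v) (allFin n))

  -- No δ satisfies this when n = 0.
  IsMinDegree : ℕ → Set
  IsMinDegree = IsMinimum (λ d → ∃[ v ] degree v ≡ d)

  -- The vertices burned after one more round with activator a, where B is the
  -- set of vertices burned in earlier rounds.
  step : Pred (Fin n) 0ℓ → Fin n → Pred (Fin n) 0ℓ
  step B a v = B v ⊎ (∃[ u ] Adj v u × B u) ⊎ v ≡ a

  burn : Pred (Fin n) 0ℓ → Vec (Fin n) m → Pred (Fin n) 0ℓ
  burn B []       = B
  burn B (a ∷ as) = burn (step B a) as

  Burns : Vec (Fin n) m → Set
  Burns as = ∀ v → burn ∅ as v

  BurnsIn : ℕ → Set
  BurnsIn m = Σ (Vec (Fin n) m) Burns

  private
    burn? : ∀ {B} → Decidable B → (as : Vec (Fin n) m) → Decidable (burn B as)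
    burn? B? []       = B?
    burn? B? (a ∷ as) =
      burn? (λ v → B? v ⊎-dec (any? (λ u → adj? v u ×-dec B? u) ⊎-dec v ≟ a)) as

    anyVec? : ∀ m {P : Pred (Vec (Fin n) m) 0ℓ} → Decidable P → Dec (∃ P)
    anyVec? zero    P? = map′ ([] ,_) (λ { ([] , q) → q }) (P? [])
    anyVec? (suc m) P? =
      map′ (λ { (a , as , q) → a ∷ as , q }) (λ { (a ∷ as , q) → a , as , q })
           (any? λ a → anyVec? m (P? ∘ (a ∷_)))

    burn-⊇ : ∀ {B v} (as : Vec (Fin n) m) → B v → burn B as v
    burn-⊇ []       b = b
    burn-⊇ (_ ∷ as) b = burn-⊇ as (inj₁ b)

    burn-∈ : ∀ {B v} {as : Vec (Fin n) m} → v ∈ as → burn B as v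
    burn-∈ {as = _ ∷ as} (here v≡a)  = burn-⊇ as (inj₂ (inj₂ v≡a))
    burn-∈               (there v∈as) = burn-∈ v∈as

  burnsIn? : Decidable BurnsIn
  burnsIn? m = anyVec? m (λ as → all? (burn? ∅? as))

  leastBurningTime : ∃ (IsMinimum BurnsIn)
  leastBurningTime = least burnsIn? (n , Vec.allFin n , λ v → burn-∈ (∈-allFin⁺ v))

  burningNumber : ℕ
  burningNumber = proj₁ leastBurningTime

{-# OPTIONS --safe #-}

-- Let m = ⌈√n⌉ and choose a_i greedily outside the balls B(a_k, m − k), k < i.
-- If this never covers the graph, then d(a_k, a_i) > m − k for k < i, so the
-- balls about a_i of radius ⌊(m − i)/2⌋ are pairwise disjoint.  None of them is
-- the whole graph, and when δ ≥ 23 a ball of radius r missing some vertex has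
-- at least 8r vertices, since every third sphere contributes a whole closed
-- neighbourhood.  For m ≥ 5 the total 8 Σ_{j<m} ⌊j/2⌋ exceeds m² ≥ n.
module Submission where

open import Defs
open import Data.Empty using (⊥)
open import Data.Fin using (Fin; zero; suc)
open import Data.Fin.Properties using (_≟_; any?; injective⇒≤)
open import Data.List using (List; []; _∷_; _++_; length; filter; allFin; lookup)
open import Data.List.Membership.Propositional.Properties using (∈-lookup)
open import Data.List.Properties using (length-++; length-filter; length-tabulate)
open import Data.List.Relation.Unary.All as All using (All; []; _∷_)
open import Data.List.Relation.Unary.All.Properties using (++⁺; all-filter)
open import Data.List.Relation.Unary.AllPairs using ([]; _∷_)
open import Data.List.Relation.Unary.Unique.Propositional using (Unique)
import Data.List.Relation.Unary.Unique.Propositional.Properties as Unique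
open import Data.Nat using (ℕ; zero; suc; _+_; _*_; _≤_; _<_; z≤n; s≤s; ⌊_/2⌋; ⌈_/2⌉)
open import Data.Nat.Properties hiding (_≟_)
open import Data.Nat.Solver using (module +-*-Solver)
open import Data.Product using (∃; ∃-syntax; _×_; _,_; proj₁; proj₂)
open import Data.Sum as Sum using (_⊎_; inj₁; inj₂)
open import Data.Vec using (Vec; []; _∷_; replicate)
open import Function using (id; _∘_)
open import Level using (0ℓ)
open import Relation.Binary.Construct.Closure.ReflexiveTransitive using (Star; ε; _◅_)
open import Relation.Binary.PropositionalEquality using (_≡_; refl; sym; cong; subst)
open import Relation.Nullary using (¬_; yes; no; contradiction; ¬?; _×-dec_; _⊎-dec_)
open import Relation.Nullary.Decidable using (decidable-stable)
open import Relation.Unary using (Pred; Decidable; _⊆_; ∅)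

private variable
  n k l m : ℕ

module _ {A : Set} where

  lookup-injective : {xs : List A} → Unique xs → ∀ {i j} → lookup xs i ≡ lookup xs j → i ≡ j
  lookup-injective {_ ∷ _} _        {zero}  {zero}  _  = refl
  lookup-injective {_ ∷ _} (x∉ ∷ _) {zero}  {suc j} eq = contradiction eq (All.lookup x∉ (∈-lookup j))
  lookup-injective {_ ∷ _} (x∉ ∷ _) {suc i} {zero}  eq = contradiction (sym eq) (All.lookup x∉ (∈-lookup i))
  lookup-injective {_ ∷ _} (_ ∷ u)  {suc i} {suc j} eq = cong suc (lookup-injective u eq)

  -- Disjointness is asked of two predicates, because the lists are known only through the balls
  -- that contain them.
  ++-unique : {P Q : Pred A 0ℓ} {xs ys : List A} → (∀ {x} → P x → Q x → ⊥) →
    All P xs → All Q ys → Unique xs → Unique ys → Unique (xs ++ ys)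
  ++-unique disjoint ps qs u v =
    Unique.++⁺ u v λ (x∈xs , x∈ys) → disjoint (All.lookup ps x∈xs) (All.lookup qs x∈ys)

unique⇒length≤ : {xs : List (Fin n)} → Unique xs → length xs ≤ n
unique⇒length≤ u = injective⇒≤ (lookup-injective u)

-- The summand `8 * ⌊ m /2⌋` is the share of an activator that has `m` rounds left after it.
packed : ℕ → ℕ
packed zero    = 0
packed (suc m) = 8 * ⌊ m /2⌋ + packed m

-- Induction in steps of two: from `j` to `2 + j` the square grows by 4j + 4 and `packed` by 8(⌊j/2⌋
-- + ⌈j/2⌉) = 8j. At `m = 4` both sides equal 16.
square<packed : 5 ≤ m → m * m < packed m
square<packed {m} 5≤m with m≤n⇒∃[o]m+o≡n 5≤m
... | o , refl = from5 o
  where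
  open ≤-Reasoning
  open +-*-Solver
  from5 : ∀ o → (5 + o) * (5 + o) < packed (5 + o)
  from5 zero          = m≤m+n 26 6
  from5 (suc zero)    = m≤m+n 37 11
  from5 (suc (suc o)) = let j = 5 + o in begin-strict
    (2 + j) * (2 + j)                      ≡⟨ solve 1 (λ o → let j = con 5 :+ o in
                                                (con 2 :+ j) :* (con 2 :+ j) := j :* j :+ (con 4 :* j :+ con 4)) refl o ⟩
    j * j + (4 * j + 4)                    <⟨ +-mono-<-≤ (from5 o) (+-monoʳ-≤ (4 * j) (m≤m+n 4 (16 + 4 * o))) ⟩
    packed j + (4 * j + (20 + 4 * o))      ≡⟨ solve 2 (λ p o → let j = con 5 :+ o in
                                                p :+ (con 4 :* j :+ (con 20 :+ con 4 :* o)) := con 8 :* j :+ p) refl (packed j) o ⟩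
    8 * j + packed j                       ≡⟨ cong (λ i → 8 * i + packed j) (⌊n/2⌋+⌈n/2⌉≡n j) ⟨
    8 * (⌊ j /2⌋ + ⌈ j /2⌉) + packed j     ≡⟨ solve 3 (λ a b p →
                                                con 8 :* (a :+ b) :+ p := con 8 :* b :+ (con 8 :* a :+ p)) refl ⌊ j /2⌋ ⌈ j /2⌉ (packed j) ⟩
    packed (2 + j)                         ∎

module _ (G : Graph n) where
  open Graph G renaming (sym to adj-sym)

  -- This is d(u, v) ≤ k, given by the recursion that `step` follows, so that balls and fire compare
  -- without a distance function.
  Ball : Fin n → ℕ → Pred (Fin n) 0ℓ
  Ball u zero    v = v ≡ u
  Ball u (suc k) v = Ball u k v ⊎ ∃[ w ] Adj v w × Ball u k w

  ball? : ∀ u k → Decidable (Ball u k)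
  ball? u zero    v = v ≟ u
  ball? u (suc k) v = ball? u k v ⊎-dec any? λ w → adj? v w ×-dec ball? u k w

  ball-centre : ∀ {u} k → Ball u k u
  ball-centre zero    = refl
  ball-centre (suc k) = inj₁ (ball-centre k)

  ball-trans : ∀ {u v w} l → Ball u k v → Ball v l w → Ball u (l + k) w
  ball-trans zero    p refl               = p
  ball-trans (suc l) p (inj₁ q)           = inj₁ (ball-trans l p q)
  ball-trans (suc l) p (inj₂ (x , e , q)) = inj₂ (x , e , ball-trans l p q)

  ball-mono : ∀ {u} → k ≤ l → Ball u k ⊆ Ball u l
  ball-mono {k} k≤l p with m≤n⇒∃[o]m+o≡n k≤l
  ... | o , refl rewrite +-comm k o = ball-trans o p (ball-centre o)

  ball-sym : ∀ {u v} k → Ball u k v → Ball v k u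
  ball-sym zero    refl     = refl
  ball-sym (suc k) (inj₁ p) = inj₁ (ball-sym k p)
  ball-sym {u} {v} (suc k) (inj₂ (w , e , p)) =
    subst (λ l → Ball v l u) (+-comm k 1) (ball-trans k (inj₂ (_ , adj-sym e , refl)) (ball-sym k p))

  -- Some edge of the walk leaves `P`. When `P` is a ball, `y` lies exactly one beyond its radius.
  exit : ∀ {P : Pred (Fin n) 0ℓ} → Decidable P → ∀ {u v} → Star Adj u v → P u → ¬ P v →
    ∃[ x ] ∃[ y ] Adj x y × P x × ¬ P y
  exit P? ε              pu ¬pv = contradiction pu ¬pv
  exit P? (_◅_ {j = w} e es) pu ¬pv with P? w
  ... | yes pw = exit P? es pw ¬pv
  ... | no ¬pw = _ , w , e , pu , ¬pw

  -- Closed neighbourhoods, so that degree 23 yields 24 = 8 · 3 vertices, enough to pay for three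
  -- radii.
  neighbours : Fin n → List (Fin n)
  neighbours v = v ∷ filter (adj? v) (allFin n)

  neighbours-unique : ∀ v → Unique (neighbours v)
  neighbours-unique v =
    All.map (λ e v≡w → irrefl v≡w e) (all-filter (adj? v) (allFin n)) ∷ Unique.filter⁺ (adj? v) (Unique.allFin⁺ n)

  neighbours-ball : ∀ v → All (Ball v 1) (neighbours v)
  neighbours-ball v =
    inj₁ refl ∷ All.map (λ e → inj₂ (v , adj-sym e , refl)) (all-filter (adj? v) (allFin n))

  degree≤n : ∀ v → degree G v ≤ n
  degree≤n v = ≤-trans (length-filter (adj? v) (allFin n)) (≤-reflexive (length-tabulate id))

  burn-mono : ∀ {B C : Pred (Fin n) 0ℓ} (as : Vec (Fin n) m) → B ⊆ C → burn G B as ⊆ burn G C as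
  burn-mono []       B⊆C = B⊆C
  burn-mono (a ∷ as) B⊆C = burn-mono as
    (Sum.map B⊆C (Sum.map (λ (u , e , b) → u , e , B⊆C b) id))

  -- Fire advances by one in each round, whatever the activators are.
  ball⊆burn : ∀ {B : Pred (Fin n) 0ℓ} {u} (as : Vec (Fin n) m) → Ball u k ⊆ B → Ball u (m + k) ⊆ burn G B as
  ball⊆burn [] ball⊆B p = ball⊆B p
  ball⊆burn {suc m} {k} {u = u} (_ ∷ as) ball⊆B {x} p =
    ball⊆burn as (Sum.map ball⊆B λ (w , e , q) → inj₁ (w , e , ball⊆B q))
      (subst (λ l → Ball u l x) (sym (+-suc m k)) p)

  module _ (connected : Connected G) (deg≥ : ∀ v → 23 ≤ degree G v) where

    -- Induction in steps of three. At radius 3 + r, a vertex `y` at distance exactly r + 2 exists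
    -- since the ball misses `w`; its closed neighbourhood stays within distance r + 3 and avoids
    -- the ball of radius r, adding 24 vertices.
    ball-size : ∀ {u w} r → ¬ Ball u r w → ∃[ xs ] Unique xs × All (Ball u r) xs × 8 * r ≤ length xs
    ball-size 0 _ = [] , [] , [] , z≤n
    ball-size {u} 1 _ = neighbours u , neighbours-unique u , neighbours-ball u ,
      ≤-trans (m≤m+n 8 16) (s≤s (deg≥ u))
    ball-size {u} 2 _ = neighbours u , neighbours-unique u , All.map inj₁ (neighbours-ball u) ,
      ≤-trans (m≤m+n 16 8) (s≤s (deg≥ u))
    ball-size {u} {w} (suc (suc (suc r))) w∉
      with ball-size r (w∉ ∘ ball-mono (m≤n+m r 3))
         | exit (ball? u (1 + r)) (connected u w) (ball-centre (1 + r)) (w∉ ∘ ball-mono (m≤n+m (1 + r) 2))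
    ... | xs , xs-unique , xs∈ , size | x , y , e , x∈ , y∉ =
      neighbours y ++ xs ,
      ++-unique (λ z∈N z∈ → y∉ (ball-trans 1 z∈ (ball-sym 1 z∈N)))
        (neighbours-ball y) xs∈ (neighbours-unique y) xs-unique ,
      ++⁺ (All.map (ball-trans 1 (inj₂ (x , adj-sym e , x∈))) (neighbours-ball y))
        (All.map (ball-mono (m≤n+m r 3)) xs∈) ,
      (begin
        8 * (3 + r)                      ≡⟨ *-distribˡ-+ 8 3 r ⟩
        24 + 8 * r                       ≤⟨ +-mono-≤ (s≤s (deg≥ y)) size ⟩
        length (neighbours y) + length xs ≡⟨ length-++ (neighbours y) ⟨
        length (neighbours y ++ xs)      ∎)
      where open ≤-Reasoning

    -- P is the region covered by earlier activators; m rounds remain.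
    burn-or-pack : Fin n → ∀ m {P : Pred (Fin n) 0ℓ} → Decidable P →
      (∃[ as ] ∀ v → P v ⊎ burn G {m} ∅ as v) ⊎
      (∃ (¬_ ∘ P) × ∃[ xs ] Unique xs × All (λ x → ∃[ a ] ¬ P a × Ball a ⌊ m /2⌋ x) xs × packed m ≤ length xs)
    burn-or-pack v₀ m P? with any? (¬? ∘ P?)
    -- Everything is covered already; `v₀` merely fills the remaining rounds.
    ... | no all-P = inj₁ (replicate m v₀ , λ v → inj₁ (decidable-stable (P? v) λ ¬p → all-P (v , ¬p)))
    burn-or-pack v₀ zero    P? | yes missed = inj₂ (missed , [] , [] , [] , z≤n)
    -- Greedy choice: the uncovered `v` is activated, and the `m` rounds after it burn `Ball v m`.
    burn-or-pack v₀ (suc m) {P} P? | yes (v , ¬Pv) with burn-or-pack v₀ m (λ x → P? x ⊎-dec ball? v m x)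
    ... | inj₁ (as , covered) = inj₁ (v ∷ as , λ x → cover (covered x))
      where
      cover : ∀ {x} → (P x ⊎ Ball v m x) ⊎ burn G ∅ as x → P x ⊎ burn G ∅ (v ∷ as) x
      cover (inj₁ (inj₁ p)) = inj₁ p
      cover (inj₁ (inj₂ b)) =
        inj₂ (ball⊆burn {k = 0} as (inj₂ ∘ inj₂) (ball-mono (m≤m+n m 0) b))
      cover (inj₂ b) = inj₂ (burn-mono as (λ ()) b)
    ... | inj₂ ((w , ¬Q) , xs , xs-unique , xs∈ , size)
      -- The vertex `w` left over by the recursion shows that the half-radius ball of `v` is not the
      -- whole graph.
      with ball-size ⌊ m /2⌋ (λ b → ¬Q (inj₂ (ball-mono (⌊n/2⌋≤n m) b)))
    ... | ys , ys-unique , ys∈ , size′ = inj₂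
      ((v , ¬Pv) , ys ++ xs , ++-unique disjoint ys∈ xs∈ ys-unique xs-unique ,
       ++⁺ (All.map (λ b → v , ¬Pv , ball-mono half≤ b) ys∈)
         (All.map (λ (a , ¬Qa , b) → a , ¬Qa ∘ inj₁ , ball-mono half≤ b) xs∈) ,
       (begin
         8 * ⌊ m /2⌋ + packed m ≤⟨ +-mono-≤ size′ size ⟩
         length ys + length xs  ≡⟨ length-++ ys ⟨
         length (ys ++ xs)      ∎))
      where
      open ≤-Reasoning
      half≤ : ⌊ m /2⌋ ≤ ⌊ suc m /2⌋
      half≤ = ⌊n/2⌋≤⌈n/2⌉ m
      -- A common vertex would put `a` within 2⌊m/2⌋ ≤ m of `v`, yet `a` lies outside `Ball v m`.
      disjoint : ∀ {x} → Ball v ⌊ m /2⌋ x → (∃[ a ] ¬ (P a ⊎ Ball v m a) × Ball a ⌊ m /2⌋ x) → ⊥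
      disjoint x∈v (a , ¬Qa , x∈a) = ¬Qa (inj₂ (ball-mono
        (≤-trans (+-monoʳ-≤ ⌊ m /2⌋ half≤) (≤-reflexive (⌊n/2⌋+⌈n/2⌉≡n m)))
        (ball-trans ⌊ m /2⌋ x∈v (ball-sym ⌊ m /2⌋ x∈a))))

    burnsIn : Fin n → n ≤ m * m → BurnsIn G m
    burnsIn {m} v₀ n≤m² with burn-or-pack v₀ m {∅} (λ _ → no λ ())
    ... | inj₁ (as , covered) = as , λ v → Sum.[ (λ ()) , id ] (covered v)
    ... | inj₂ (_ , xs , xs-unique , _ , size) = contradiction n≤m² (<⇒≱ (begin-strict
      m * m     <⟨ square<packed 5≤m ⟩
      packed m  ≤⟨ size ⟩
      length xs ≤⟨ unique⇒length≤ xs-unique ⟩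
      n         ∎))
      where
      open ≤-Reasoning
      -- Otherwise 23 ≤ n ≤ 4² = 16.
      5≤m : 5 ≤ m
      5≤m = ≰⇒> λ m≤4 → contradiction
        (≤-trans (deg≥ v₀) (≤-trans (degree≤n v₀) (≤-trans n≤m² (*-mono-≤ m≤4 m≤4))))
        (<⇒≱ (m≤m+n 17 6))

corollary1 : ∀ {n : ℕ} (G : Graph n) (δ : ℕ) →
    Connected G → IsMinDegree G δ → 23 ≤ δ →
    burningNumber G ≤ ⌈√ n ⌉
corollary1 {n} G δ connected ((v₀ , _) , δ-least) 23≤δ =
  -- By minimality it is enough to burn in ⌈√n⌉ rounds; the vertex of minimum degree serves as the
  -- default activator.
  proj₂ (proj₂ (leastBurningTime G)) ⌈√ n ⌉
    (burnsIn G connected (λ v → ≤-trans 23≤δ (δ-least _ (v , refl))) v₀ (proj₁ (proj₂ (leastSquareRoot n))))
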